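{- Consider the instance with keys $1,\dots,5$ and weights $(w_1,\dots,w_5)=(11,23,23,13,0)$. For $j\in\{4,5\}$ let $C^{=}_{1,j}$ (respectively $C^{<}_{1,j}$) be the minimum cost of a 2WCST for the keys $\{1,\dots,j\}$ whose root is an equal-to test (respectively a less-than test). Then $C^{=}_{1,4}=141>140=C^{<}_{1,4}$, but $C^{=}_{1,5}=152<153=C^{<}_{1,5}$. Consequently, it is not true in general that if the heaviest key of an interval $[i,j]$ of keys lies in a proper subinterval $[i',j']\subsetneq[i,j]$ and the optimum choice at the root for $[i',j']$ is a less-than test, then the optimum choice at the root for $[i,j]$ is also a less-than test.
   Context: For an instance with keys $1,2,\dots,n$ (usual order) and weights $w_k\ge 0$, a two-way comparison search tree (2WCST) for a nonempty set of keys is a rooted binary decision tree whose leaves are in bijection with these keys and in which each internal node is labelled either with an equal-to test $\langle =k\rangle$ ("is $q=k$?") or a less-than test $\langle <k\rangle$ ("is $q<k$?") for a key $k$, and has two children, one for "yes" and one for "no". It is required that for each key $q$ in the set, the search for $q$ starting at the root ends in the leaf labelled $q$. Its cost is $\sum_k w_k\cdot\mathrm{depth}(k)$ over the keys in the set, where $\mathrm{depth}(k)$ is the number of comparison nodes on the path from the root to leaf $k$. -}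

module Defs where

open import Data.Bool using (Bool; _∧_; if_then_else_)
open import Data.Fin using (Fin; _≤_)
import Data.Fin.Properties as Finₚ
open import Data.Fin.Subset using (Subset; _∈_; _⊂_)
open import Data.Fin.Subset.Properties using (_∈?_)
open import Data.Integer using (+_)
open import Data.List using (List; [_]; _++_; map; filter; foldr; allFin)
open import Data.List.Membership.Propositional using () renaming (_∈_ to _∈ˡ_)
open import Data.List.Relation.Unary.Unique.Propositional using (Unique)
open import Data.Nat using (ℕ; suc)
open import Data.Product using (_×_; ∃-syntax)
open import Data.Rational using (ℚ; 0ℚ; _/_; _+_; _*_) renaming (_≤_ to _≤ℚ_)
open import Data.Vec using (tabulate; lookup; []; _∷_)
open import Function.Bundles using (_⇔_)
open import Relation.Binary.PropositionalEquality using (_≡_)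
open import Relation.Nullary using (does)

-- The keys 1, …, n are the elements of Fin n in order, so that key k is the
-- element with toℕ = k ∸ 1.

data Test (n : ℕ) : Set where
  ⟨=_⟩ : Fin n → Test n
  ⟨<_⟩ : Fin n → Test n

answer : ∀ {n} → Test n → Fin n → Bool
answer ⟨= k ⟩ q = does (q Finₚ.≟ k)
answer ⟨< k ⟩ q = does (q Finₚ.<? k)

data Tree (n : ℕ) : Set where
  leaf : Fin n → Tree n
  node : Test n → (yes no : Tree n) → Tree n

leaves : ∀ {n} → Tree n → List (Fin n)
leaves (leaf k)       = [ k ]
leaves (node _ ty tn) = leaves ty ++ leaves tn

search : ∀ {n} → Tree n → Fin n → Fin n
search (leaf k)       q = k
search (node c ty tn) q = if answer c q then search ty q else search tn q

-- Number of comparisons made when searching for q.  In a 2WCST containing q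
-- this search ends in the only leaf labelled q, so it is the depth of that leaf.
depth : ∀ {n} → Tree n → Fin n → ℕ
depth (leaf k)       q = 0
depth (node c ty tn) q = suc (if answer c q then depth ty q else depth tn q)

-- The first two fields say that the leaves are in bijection with S.  A tree
-- has at least one leaf, so S is necessarily nonempty.
record Is2WCST {n} (S : Subset n) (t : Tree n) : Set where
  field
    leaves-unique : Unique (leaves t)
    leaves-keys   : ∀ k → k ∈ˡ leaves t ⇔ k ∈ S
    correct       : ∀ q → q ∈ S → search t q ≡ q

cost : ∀ {n} → (Fin n → ℚ) → Subset n → Tree n → ℚ
cost {n} w S t =
  foldr _+_ 0ℚ (map (λ k → w k * (+ depth t k / 1)) (filter (_∈? S) (allFin n)))

data EqualRoot {n} : Tree n → Set where
  equalRoot : ∀ {k ty tn} → EqualRoot (node ⟨= k ⟩ ty tn)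

data LessRoot {n} : Tree n → Set where
  lessRoot : ∀ {k ty tn} → LessRoot (node ⟨< k ⟩ ty tn)

-- c is the minimum cost of a 2WCST for S whose root satisfies R.
IsMinCost : ∀ {n} → (Fin n → ℚ) → (Tree n → Set) → Subset n → ℚ → Set
IsMinCost w R S c =
  (∃[ t ] Is2WCST S t × R t × cost w S t ≡ c) ×
  (∀ t → Is2WCST S t → R t → c ≤ℚ cost w S t)

IsOptimal : ∀ {n} → (Fin n → ℚ) → Subset n → Tree n → Set
IsOptimal w S t = Is2WCST S t × (∀ u → Is2WCST S u → cost w S t ≤ℚ cost w S u)

-- "The optimum choice at the root for S is a less-than test" in the weak
-- sense, where an equal-to test may be equally good, …
LessOptimal : ∀ {n} → (Fin n → ℚ) → Subset n → Set
LessOptimal w S = ∃[ t ] IsOptimal w S t × LessRoot t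

-- … and in the strict sense, where only less-than tests are optimum.
LessStrictlyOptimal : ∀ {n} → (Fin n → ℚ) → Subset n → Set
LessStrictlyOptimal w S =
  LessOptimal w S × (∀ t → IsOptimal w S t → LessRoot t)

interval : ∀ {n} → Fin n → Fin n → Subset n
interval i j = tabulate λ k → does (i Finₚ.≤? k) ∧ does (k Finₚ.≤? j)

IsHeaviest : ∀ {n} → (Fin n → ℚ) → Subset n → Fin n → Set
IsHeaviest w S m = m ∈ S × (∀ k → k ∈ S → w k ≤ℚ w m)

-- If several keys of S are tied for heaviest, all of them must lie in S′.
HeaviestIn : ∀ {n} → (Fin n → ℚ) → Subset n → Subset n → Set
HeaviestIn w S S′ = ∀ m → IsHeaviest w S m → m ∈ S′

weights : Fin 5 → ℚ
weights = lookup (+ 11 / 1 ∷ + 23 / 1 ∷ + 23 / 1 ∷ + 13 / 1 ∷ + 0 / 1 ∷ [])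

-- The general claim to be refuted.  Its hypotheses are read in the strictest
-- and its conclusion in the weakest sense, so refuting it also refutes every
-- other reading of ties.
LessRootInherited : Set
LessRootInherited =
  ∀ n (w : Fin n → ℚ) → (∀ k → 0ℚ ≤ℚ w k) →
  ∀ (i j i′ j′ : Fin n) → i′ ≤ j′ →
  interval i′ j′ ⊂ interval i j →
  HeaviestIn w (interval i j) (interval i′ j′) →
  LessStrictlyOptimal w (interval i′ j′) →
  LessOptimal w (interval i j)

{-# OPTIONS --safe #-}
-- A test splits the keys searched for into those answering yes and those
-- answering no, and every one of them is charged its weight once.  Minimising
-- this recurrence over all tests, but only down to a fixed number of levels,
-- bounds the cost of every tree from below, and four levels are enough for the
-- bounds on five keys to meet the costs of explicit trees.
module Submission where

open import Data.Bool using (true; false; not)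
open import Data.Empty using (⊥-elim)
open import Data.Fin using (Fin; #_)
import Data.Fin.Properties as Finₚ
open import Data.Fin.Subset using (Subset; _∈_)
open import Data.Fin.Subset.Properties using (_∈?_; _⊂?_)
open import Data.Integer as ℤ using (+_)
import Data.Integer.Properties as ℤₚ
open import Data.List using (List; []; _∷_; _++_; map; filter; filterᵇ; foldr; allFin)
open import Data.List.Extrema.Nat using (min; min≤v⁺)
open import Data.List.Membership.DecPropositional using () renaming (_∈?_ to member?)
open import Data.List.Membership.Propositional using (lose) renaming (_∈_ to _∈ˡ_)
open import Data.List.Membership.Propositional.Properties
  using (∈-allFin; ∈-filter⁻; ∈-map⁺; ∈-++⁺ˡ; ∈-++⁺ʳ)
open import Data.List.Relation.Unary.All using (_∷_)
open import Data.List.Relation.Unary.AllPairs using (_∷_)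
open import Data.List.Relation.Unary.Any using (here; there)
open import Data.List.Relation.Unary.Unique.DecPropositional using (unique?)
open import Data.List.Relation.Unary.Unique.Propositional using (Unique)
open import Data.List.Relation.Unary.Unique.Propositional.Properties using (allFin⁺; filter⁺)
open import Data.Nat as ℕ using (ℕ; zero; suc; z≤n)
open import Data.Nat.ListAction using (sum)
import Data.Nat.Coprimality as Coprimality
import Data.Nat.Properties as ℕₚ
open import Data.Nat.Tactic.RingSolver using (solve-∀)
open import Data.Product using (_×_; _,_; proj₁; proj₂)
open import Data.Rational as ℚ using (ℚ; 0ℚ; mkℚ; _/_; _<_; _>_)
import Data.Rational.Properties as ℚₚ
open import Data.Sum using (_⊎_; inj₁; inj₂)
open import Data.Vec using (Vec; []; _∷_; lookup)
open import Data.Vec.Properties using (lookup-map)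
open import Function using (_∘_)
open import Function.Bundles using (mk⇔; Equivalence)
open import Relation.Binary.PropositionalEquality
  using (_≡_; _≢_; refl; sym; trans; cong; cong₂; subst; subst₂)
open import Relation.Nullary using (¬_; Dec; contradiction)
open import Relation.Nullary.Decidable using (map′; from-yes; _×-dec_; _→-dec_; T?)
open import Defs

-- Splitting lists of keys by a test.

passing failing : ∀ {n} → Test n → List (Fin n) → List (Fin n)
passing c = filterᵇ (answer c)
failing c = filterᵇ (not ∘ answer c)

tests : ∀ n → List (Test n)
tests n = map ⟨=_⟩ (allFin n) ++ map ⟨<_⟩ (allFin n)

∈-tests : ∀ {n} (c : Test n) → c ∈ˡ tests n
∈-tests ⟨= k ⟩ = ∈-++⁺ˡ (∈-map⁺ ⟨=_⟩ (∈-allFin k))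
∈-tests ⟨< k ⟩ = ∈-++⁺ʳ _ (∈-map⁺ ⟨<_⟩ (∈-allFin k))

-- Recording only the outcome of searches, on a list of keys, gives an invariant that passes to both
-- subtrees once the list is split by the root test.
Correct : ∀ {n} → Tree n → List (Fin n) → Set
Correct t ks = ∀ q → q ∈ˡ ks → search t q ≡ q

module _ {n} (c : Test n) (ty tn : Tree n) (ks : List (Fin n))
         (correct : Correct (node c ty tn) ks) where

  correct-passing : Correct ty (passing c ks)
  correct-passing q q∈ with ∈-filter⁻ (T? ∘ answer c) {xs = ks} q∈
  ... | q∈ks , yes with answer c q | correct q q∈ks
  ... | true | eq = eq

  correct-failing : Correct tn (failing c ks)
  correct-failing q q∈ with ∈-filter⁻ (T? ∘ not ∘ answer c) {xs = ks} q∈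
  ... | q∈ks , no with answer c q | correct q q∈ks
  ... | false | eq = eq

-- The recurrence and its lower bound, over natural weights.

module _ {n} (w : Fin n → ℕ) where

  totalWeight : List (Fin n) → ℕ
  totalWeight ks = sum (map w ks)

  pathCost : Tree n → List (Fin n) → ℕ
  pathCost t ks = sum (map (λ k → w k ℕ.* depth t k) ks)

  -- The root comparison charges every key once, giving the total weight; the rest of a key's depth
  -- is spent in the subtree that its answer selects.
  pathCost-node : ∀ c ty tn ks → pathCost (node c ty tn) ks ≡
    totalWeight ks ℕ.+ (pathCost ty (passing c ks) ℕ.+ pathCost tn (failing c ks))
  pathCost-node c ty tn []       = refl
  pathCost-node c ty tn (k ∷ ks) with answer c k | pathCost-node c ty tn ks
  ... | true  | ih rewrite ih =
    yes-case (w k) (depth ty k) (totalWeight ks)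
      (pathCost ty (passing c ks)) (pathCost tn (failing c ks))
    where
    yes-case : ∀ a d s y z →
      a ℕ.* suc d ℕ.+ (s ℕ.+ (y ℕ.+ z)) ≡ a ℕ.+ s ℕ.+ (a ℕ.* d ℕ.+ y ℕ.+ z)
    yes-case = solve-∀
  ... | false | ih rewrite ih =
    no-case (w k) (depth tn k) (totalWeight ks)
      (pathCost ty (passing c ks)) (pathCost tn (failing c ks))
    where
    no-case : ∀ a d s y z →
      a ℕ.* suc d ℕ.+ (s ℕ.+ (y ℕ.+ z)) ≡ a ℕ.+ s ℕ.+ (y ℕ.+ (a ℕ.* d ℕ.+ z))
    no-case = solve-∀

  mutual
    -- `tests` also contains tests that send all of `ks` the same way, so the list need not shrink;
    -- the number of levels is what decreases.
    levelBound : ℕ → List (Fin n) → ℕ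
    levelBound (suc l) ks@(k ∷ _ ∷ _) =
      -- `min` needs a starting value; the one chosen is itself among the candidates, so it does not
      -- alter the minimum.
      min (rootBound l ks ⟨= k ⟩) (map (rootBound l ks) (tests n))
    -- With no level left the rest is estimated by zero; with at most one key nothing remains to be
    -- compared.
    levelBound _       _              = 0

    rootBound : ℕ → List (Fin n) → Test n → ℕ
    rootBound l ks c =
      totalWeight ks ℕ.+ (levelBound l (passing c ks) ℕ.+ levelBound l (failing c ks))

  levelBound≤rootBound : ∀ l ks c → levelBound (suc l) ks ℕ.≤ rootBound l ks c
  levelBound≤rootBound l []       c = z≤n
  levelBound≤rootBound l (_ ∷ []) c = z≤n
  levelBound≤rootBound l ks@(_ ∷ _ ∷ _) c =
    min≤v⁺ _ _ (inj₂ (lose (∈-map⁺ (rootBound l ks) (∈-tests c)) ℕₚ.≤-refl))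

  mutual
    levelBound≤pathCost : ∀ l t ks → Unique ks → Correct t ks →
                          levelBound l ks ℕ.≤ pathCost t ks
    levelBound≤pathCost zero    t        ks       uniq correct = z≤n
    levelBound≤pathCost (suc l) (leaf k) []       uniq correct = z≤n
    levelBound≤pathCost (suc l) (leaf k) (_ ∷ []) uniq correct = z≤n
    -- A leaf answers both searches with the same key, which two distinct keys rule out.
    levelBound≤pathCost (suc l) (leaf k) (x ∷ y ∷ _) ((x≢y ∷ _) ∷ _) correct =
      contradiction (trans (sym (correct x (here refl))) (correct y (there (here refl)))) x≢y
    levelBound≤pathCost (suc l) t@(node c ty tn) ks uniq correct =
      ℕₚ.≤-trans (levelBound≤rootBound l ks c) (rootBound≤pathCost l c ty tn ks uniq correct)

    -- Keeping the root test fixed, instead of minimising over it, is what allows separate bounds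
    -- for equal-to and less-than roots.
    rootBound≤pathCost : ∀ l c ty tn ks → Unique ks → Correct (node c ty tn) ks →
                         rootBound l ks c ℕ.≤ pathCost (node c ty tn) ks
    rootBound≤pathCost l c ty tn ks uniq correct =
      subst (rootBound l ks c ℕ.≤_) (sym (pathCost-node c ty tn ks))
        (ℕₚ.+-monoʳ-≤ (totalWeight ks) (ℕₚ.+-mono-≤
          (levelBound≤pathCost l ty (passing c ks) (filter⁺ _ uniq)
            (correct-passing c ty tn ks correct))
          (levelBound≤pathCost l tn (failing c ks) (filter⁺ _ uniq)
            (correct-failing c ty tn ks correct))))

-- Transfer from natural to rational costs.

fromℕ : ℕ → ℚ
fromℕ m = + m / 1

-- The normalisation inside `_/_` is stuck on a variable `m`; the explicit numerator and denominator
-- let sums, products and comparisons unfold.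
fromℕ≡mkℚ : ∀ m → fromℕ m ≡ mkℚ (+ m) 0 (Coprimality.sym (Coprimality.1-coprimeTo m))
fromℕ≡mkℚ m = ℚₚ.normalize-coprime _

fromℕ-homo-+ : ∀ m n → fromℕ m ℚ.+ fromℕ n ≡ fromℕ (m ℕ.+ n)
fromℕ-homo-+ m n = trans (cong₂ ℚ._+_ (fromℕ≡mkℚ m) (fromℕ≡mkℚ n))
  (cong (_/ 1) (cong₂ ℤ._+_ (ℤₚ.*-identityʳ (+ m)) (ℤₚ.*-identityʳ (+ n))))

fromℕ-homo-* : ∀ m n → fromℕ m ℚ.* fromℕ n ≡ fromℕ (m ℕ.* n)
fromℕ-homo-* m n = trans (cong₂ ℚ._*_ (fromℕ≡mkℚ m) (fromℕ≡mkℚ n))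
  (cong (_/ 1) (sym (ℤₚ.pos-* m n)))

fromℕ-mono-≤ : ∀ {m n} → m ℕ.≤ n → fromℕ m ℚ.≤ fromℕ n
fromℕ-mono-≤ {m} {n} m≤n = subst₂ ℚ._≤_ (sym (fromℕ≡mkℚ m)) (sym (fromℕ≡mkℚ n))
  (ℚ.*≤* (ℤₚ.*-monoʳ-≤-nonNeg (+ 1) (ℤ.+≤+ m≤n)))

keysOf : ∀ {n} → Subset n → List (Fin n)
keysOf S = filter (_∈? S) (allFin _)

module _ {n} {w : Fin n → ℚ} {v : Fin n → ℕ} (w≡v : ∀ k → w k ≡ fromℕ (v k)) where

  cost≡pathCost : ∀ S t → cost w S t ≡ fromℕ (pathCost v t (keysOf S))
  cost≡pathCost S t = go (keysOf S)
    where
    go : ∀ ks → foldr ℚ._+_ 0ℚ (map (λ k → w k ℚ.* fromℕ (depth t k)) ks) ≡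
                fromℕ (pathCost v t ks)
    go []       = refl
    go (k ∷ ks) = trans
      (cong₂ ℚ._+_
        (trans (cong (ℚ._* fromℕ (depth t k)) (w≡v k)) (fromℕ-homo-* (v k) (depth t k)))
        (go ks))
      (fromℕ-homo-+ (v k ℕ.* depth t k) (pathCost v t ks))

  rootBound≤cost : ∀ S c {ty tn b} l → Is2WCST S (node c ty tn) →
                   b ℕ.≤ rootBound v l (keysOf S) c → fromℕ b ℚ.≤ cost w S (node c ty tn)
  rootBound≤cost S c {ty} {tn} {b} l tree b≤ =
    subst (fromℕ b ℚ.≤_) (sym (cost≡pathCost S (node c ty tn))) (fromℕ-mono-≤ (ℕₚ.≤-trans b≤
      (rootBound≤pathCost v l c ty tn (keysOf S) (filter⁺ _ (allFin⁺ n))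
        λ q q∈ → Is2WCST.correct tree q (proj₂ (∈-filter⁻ (_∈? S) {xs = allFin n} q∈)))))

-- All quantifiers range over finite sets, so evaluation certifies the explicit trees below.
is2WCST? : ∀ {n} (S : Subset n) t → Dec (Is2WCST S t)
is2WCST? S t = map′
  (λ (unique , keys , correct) → record
    { leaves-unique = unique
    ; leaves-keys   = λ k → mk⇔ (proj₁ (keys k)) (proj₂ (keys k))
    ; correct       = correct
    })
  (λ r → let open Is2WCST r in
     leaves-unique ,
     (λ k → Equivalence.to (leaves-keys k) , Equivalence.from (leaves-keys k)) ,
     correct)
  (unique? Finₚ._≟_ (leaves t)
    ×-dec Finₚ.all? (λ k → (in-leaves? k →-dec (k ∈? S)) ×-dec ((k ∈? S) →-dec in-leaves? k))
    ×-dec Finₚ.all? (λ q → (q ∈? S) →-dec (search t q Finₚ.≟ q)))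
  where
  in-leaves? : ∀ k → Dec (k ∈ˡ leaves t)
  in-leaves? k = member? Finₚ._≟_ k (leaves t)

-- A lone leaf cannot answer two different keys correctly, so the two kinds of root exhaust all
-- trees.
root : ∀ {n S} {t : Tree n} {x y} → Is2WCST S t → x ∈ S → y ∈ S → x ≢ y →
       EqualRoot t ⊎ LessRoot t
root {t = leaf _} tree x∈S y∈S x≢y =
  contradiction (trans (sym (correct _ x∈S)) (correct _ y∈S)) x≢y
  where open Is2WCST tree
root {t = node ⟨= _ ⟩ _ _} _ _ _ _ = inj₁ equalRoot
root {t = node ⟨< _ ⟩ _ _} _ _ _ _ = inj₂ lessRoot

-- The instance and its four minimum costs.

natWeights : Vec ℕ 5
natWeights = 11 ∷ 23 ∷ 23 ∷ 13 ∷ 0 ∷ []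

weights≡ : ∀ k → weights k ≡ fromℕ (lookup natWeights k)
weights≡ k = lookup-map k fromℕ natWeights

keys₄ keys₅ : Subset 5
keys₄ = interval (# 0) (# 3)
keys₅ = interval (# 0) (# 4)

-- Adding the last key, of weight 0, pushes one leaf a level down. In the equal-to tree this can be
-- key 1, raising 141 by 11; in the less-than tree it is key 4, raising 140 by 13. This reverses the
-- order.
equalTree₄ lessTree₄ equalTree₅ lessTree₅ : Tree 5
equalTree₄ = node ⟨= # 1 ⟩ (leaf (# 1)) (node ⟨= # 2 ⟩ (leaf (# 2))
  (node ⟨= # 0 ⟩ (leaf (# 0)) (leaf (# 3))))
lessTree₄ = node ⟨< # 2 ⟩ (node ⟨= # 0 ⟩ (leaf (# 0)) (leaf (# 1)))
  (node ⟨= # 2 ⟩ (leaf (# 2)) (leaf (# 3)))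
equalTree₅ = node ⟨= # 1 ⟩ (leaf (# 1)) (node ⟨= # 2 ⟩ (leaf (# 2))
  (node ⟨= # 3 ⟩ (leaf (# 3)) (node ⟨= # 0 ⟩ (leaf (# 0)) (leaf (# 4)))))
lessTree₅ = node ⟨< # 2 ⟩ (node ⟨= # 0 ⟩ (leaf (# 0)) (leaf (# 1)))
  (node ⟨= # 2 ⟩ (leaf (# 2)) (node ⟨= # 3 ⟩ (leaf (# 3)) (leaf (# 4))))

fourLevelBound : Subset 5 → Test 5 → ℕ
-- The root is the first of the four levels, so 3 remain below it.
fourLevelBound S = rootBound (lookup natWeights) 3 (keysOf S)

module _ (S : Subset 5) (b : ℕ) where

  -- The given tree attains `b`, and checking the bound for each of the five possible root tests
  -- excludes anything cheaper.
  minCost-equalRoot : ∀ t → Is2WCST S t → EqualRoot t → cost weights S t ≡ fromℕ b →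
    (∀ k → b ℕ.≤ fourLevelBound S ⟨= k ⟩) →
    IsMinCost weights EqualRoot S (fromℕ b)
  minCost-equalRoot t tree isEqual eq b≤ = (t , tree , isEqual , eq) ,
    λ { _ tree′ (equalRoot {k}) → rootBound≤cost weights≡ S ⟨= k ⟩ 3 tree′ (b≤ k) }

  minCost-lessRoot : ∀ t → Is2WCST S t → LessRoot t → cost weights S t ≡ fromℕ b →
    (∀ k → b ℕ.≤ fourLevelBound S ⟨< k ⟩) →
    IsMinCost weights LessRoot S (fromℕ b)
  minCost-lessRoot t tree isLess eq b≤ = (t , tree , isLess , eq) ,
    λ { _ tree′ (lessRoot {k}) → rootBound≤cost weights≡ S ⟨< k ⟩ 3 tree′ (b≤ k) }

equal₄ : IsMinCost weights EqualRoot keys₄ (fromℕ 141)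
equal₄ = minCost-equalRoot keys₄ 141 equalTree₄
  (from-yes (is2WCST? keys₄ equalTree₄)) equalRoot refl
  (from-yes (Finₚ.all? λ k → 141 ℕ.≤? fourLevelBound keys₄ ⟨= k ⟩))

less₄ : IsMinCost weights LessRoot keys₄ (fromℕ 140)
less₄ = minCost-lessRoot keys₄ 140 lessTree₄
  (from-yes (is2WCST? keys₄ lessTree₄)) lessRoot refl
  (from-yes (Finₚ.all? λ k → 140 ℕ.≤? fourLevelBound keys₄ ⟨< k ⟩))

equal₅ : IsMinCost weights EqualRoot keys₅ (fromℕ 152)
equal₅ = minCost-equalRoot keys₅ 152 equalTree₅
  (from-yes (is2WCST? keys₅ equalTree₅)) equalRoot refl
  (from-yes (Finₚ.all? λ k → 152 ℕ.≤? fourLevelBound keys₅ ⟨= k ⟩))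

less₅ : IsMinCost weights LessRoot keys₅ (fromℕ 153)
less₅ = minCost-lessRoot keys₅ 153 lessTree₅
  (from-yes (is2WCST? keys₅ lessTree₅)) lessRoot refl
  (from-yes (Finₚ.all? λ k → 153 ℕ.≤? fourLevelBound keys₅ ⟨< k ⟩))

141>140 : fromℕ 141 > fromℕ 140
141>140 = from-yes (fromℕ 140 ℚₚ.<? fromℕ 141)

152<153 : fromℕ 152 < fromℕ 153
152<153 = from-yes (fromℕ 152 ℚₚ.<? fromℕ 153)

-- From minimum costs to the optimum kind of root.

module _ {n} (w : Fin n → ℚ) (S : Subset n) {e l : ℚ}
         (equal : IsMinCost w EqualRoot S e) (less : IsMinCost w LessRoot S l) where

  lessStrictlyOptimal : ∀ {x y} → x ∈ S → y ∈ S → x ≢ y → l < e → LessStrictlyOptimal w S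
  lessStrictlyOptimal x∈S y∈S x≢y l<e =
    (t , (tree , optimal) , isLess) ,
    λ u (treeᵤ , optᵤ) → strict u treeᵤ optᵤ (root treeᵤ x∈S y∈S x≢y)
    where
    t      = proj₁ (proj₁ less)
    tree   = proj₁ (proj₂ (proj₁ less))
    isLess = proj₁ (proj₂ (proj₂ (proj₁ less)))
    cost≡l = proj₂ (proj₂ (proj₂ (proj₁ less)))
    optimal : ∀ u → Is2WCST S u → cost w S t ℚ.≤ cost w S u
    optimal u treeᵤ rewrite cost≡l with root treeᵤ x∈S y∈S x≢y
    ... | inj₁ isEqual = ℚₚ.≤-trans (ℚₚ.<⇒≤ l<e) (proj₂ equal u treeᵤ isEqual)
    ... | inj₂ isLessᵤ = proj₂ less u treeᵤ isLessᵤ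
    strict : ∀ u → Is2WCST S u → (∀ v → Is2WCST S v → cost w S u ℚ.≤ cost w S v) →
             EqualRoot u ⊎ LessRoot u → LessRoot u
    strict u treeᵤ optᵤ (inj₂ isLessᵤ) = isLessᵤ
    -- An optimal tree with an equal-to root would give `l < e ≤ cost w S u ≤ cost w S t = l`.
    strict u treeᵤ optᵤ (inj₁ isEqual) = ⊥-elim (ℚₚ.<-irrefl refl (ℚₚ.<-≤-trans l<e
      (ℚₚ.≤-trans (proj₂ equal u treeᵤ isEqual) (subst (cost w S u ℚ.≤_) cost≡l (optᵤ t tree)))))

  -- The equal-to tree of cost `e` undercuts every tree with a less-than root.
  ¬lessOptimal : e < l → ¬ LessOptimal w S
  ¬lessOptimal e<l (t , (tree , optimal) , isLess) with proj₁ equal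
  ... | u , treeᵤ , _ , cost≡e = ℚₚ.<-irrefl refl (ℚₚ.<-≤-trans e<l
    (ℚₚ.≤-trans (proj₂ less t tree isLess) (subst (cost w S t ℚ.≤_) cost≡e (optimal u treeᵤ))))

-- Keys 2 and 3 tie for heaviest with weight 23, and both lie in the smaller interval.
heaviestIn-keys₄ : HeaviestIn weights keys₅ keys₄
heaviestIn-keys₄ = from-yes (Finₚ.all? λ m →
  ((m ∈? keys₅) ×-dec Finₚ.all? (λ k → (k ∈? keys₅) →-dec (weights k ℚₚ.≤? weights m)))
    →-dec (m ∈? keys₄))

¬lessRootInherited : ¬ LessRootInherited
¬lessRootInherited inherited = ¬lessOptimal weights keys₅ equal₅ less₅ 152<153
  (inherited 5 weights (from-yes (Finₚ.all? λ k → 0ℚ ℚₚ.≤? weights k))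
    (# 0) (# 4) (# 0) (# 3) z≤n (from-yes (keys₄ ⊂? keys₅)) heaviestIn-keys₄
    -- Keys `# 0` and `# 1` serve as the two distinct members that exclude a single leaf.
    (lessStrictlyOptimal weights keys₄ equal₄ less₄ {# 0} {# 1}
      (from-yes (# 0 ∈? keys₄)) (from-yes (# 1 ∈? keys₄)) (λ ()) 141>140))

mainTheorem10 : ( IsMinCost weights EqualRoot (interval (# 0) (# 3)) (+ 141 / 1)
    × + 141 / 1 > + 140 / 1
    × IsMinCost weights LessRoot (interval (# 0) (# 3)) (+ 140 / 1) )
    ×
    ( IsMinCost weights EqualRoot (interval (# 0) (# 4)) (+ 152 / 1)
    × + 152 / 1 < + 153 / 1
    × IsMinCost weights LessRoot (interval (# 0) (# 4)) (+ 153 / 1) )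
    ×
    ¬ LessRootInherited
mainTheorem10 =
  (equal₄ , 141>140 , less₄) , (equal₅ , 152<153 , less₅) , ¬lessRootInherited
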